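{- Let $T$ be a tree with $n$ vertices. Then $\mathrm{Min4PC}_T$ is isometrically $\ell_1$-embeddable in $\mathbb{R}^{n-1}$; that is, there is a map $\phi:\mathcal{V}_2\to\mathbb{R}^{n-1}$ such that for all $\{i,j\},\{s,t\}\in\mathcal{V}_2$, $\mathrm{Min4PC}_T(\{i,j\},\{s,t\})=\lVert\phi(\{i,j\})-\phi(\{s,t\})\rVert_1$.
   Context: For a tree $T$ with vertex set $V$, $d_{i,j}$ denotes the distance between vertices $i,j$, and $\mathcal{V}_2$ is the set of 2-element subsets of $V$. The matrix $\mathrm{Min4PC}_T$ is the $\binom n2\times\binom n2$ matrix with rows and columns indexed by $\mathcal{V}_2$ whose entry in row $\{i,j\}$ and column $\{k,l\}$ is $\min\{d_{i,l}+d_{j,k},\ d_{i,k}+d_{j,l},\ d_{i,j}+d_{k,l}\}$. -}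

module Defs where

open import Data.Empty using (⊥-elim)
open import Data.Fin.Base as Fin using (Fin; zero; suc; inject₁; fromℕ)
open import Data.Fin.Properties as Fin using (any?; <-cmp)
import Data.Integer.Base as ℤ
open import Data.Nat.Base as ℕ using (ℕ; zero; suc; z≤n; s≤s)
import Data.Nat.Properties as ℕ
open import Data.Product.Base using (∃; _×_; _,_; proj₁; proj₂)
open import Data.Rational.Base as ℚ using (ℚ; 0ℚ; ½)
import Data.Rational.Properties as ℚ
open import Data.Rational.Solver using (module +-*-Solver)
open import Data.Sum.Base using (inj₁; inj₂)
open import Data.Vec.Functional using (Vector; foldr; map; zipWith)
open import Function.Definitions using (Injective)
open import Level using (0ℓ)
open import Relation.Binary.Core using (Rel)
open import Relation.Binary.Definitions using (Decidable; Irreflexive; Symmetric; tri<; tri≈; tri>)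
open import Relation.Binary.PropositionalEquality
open import Relation.Binary.Structures using (IsEquivalence)
open import Relation.Nullary using (¬_; Dec; yes; no)
open import Relation.Nullary.Decidable using (map′; _×-dec_)
import Relation.Unary as U

module RationalLemmas where
  open +-*-Solver
  open ℚ.≤-Reasoning

  half-pos : ∀ {ε} → 0ℚ ℚ.< ε → 0ℚ ℚ.< ½ ℚ.* ε
  half-pos {ε} 0<ε = ℚ.positive⁻¹ _ {{ℚ.pos*pos⇒pos ½ ε {{ℚ.positive 0<ε}}}}

  halves : ∀ ε → ½ ℚ.* ε ℚ.+ ½ ℚ.* ε ≡ ε
  halves ε = trans (sym (ℚ.*-distribʳ-+ ε ½ ½)) (ℚ.*-identityˡ ε)

  dist-sym : ∀ p q → ℚ.∣ p ℚ.- q ∣ ≡ ℚ.∣ q ℚ.- p ∣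
  dist-sym p q = trans (cong ℚ.∣_∣ (solve 2 (λ a b → a :- b := :- (b :- a)) refl p q))
                       (ℚ.∣-p∣≡∣p∣ (q ℚ.- p))

  dist-+ : ∀ p q r s → ℚ.∣ (p ℚ.+ q) ℚ.- (r ℚ.+ s) ∣ ℚ.≤ ℚ.∣ p ℚ.- r ∣ ℚ.+ ℚ.∣ q ℚ.- s ∣
  dist-+ p q r s = begin
    ℚ.∣ (p ℚ.+ q) ℚ.- (r ℚ.+ s) ∣
      ≡⟨ cong ℚ.∣_∣ (solve 4 (λ a b c d → (a :+ b) :- (c :+ d) := (a :- c) :+ (b :- d)) refl p q r s) ⟩
    ℚ.∣ (p ℚ.- r) ℚ.+ (q ℚ.- s) ∣
      ≤⟨ ℚ.∣p+q∣≤∣p∣+∣q∣ (p ℚ.- r) (q ℚ.- s) ⟩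
    ℚ.∣ p ℚ.- r ∣ ℚ.+ ℚ.∣ q ℚ.- s ∣ ∎

  dist-triangle : ∀ p q r → ℚ.∣ p ℚ.- r ∣ ℚ.≤ ℚ.∣ p ℚ.- q ∣ ℚ.+ ℚ.∣ q ℚ.- r ∣
  dist-triangle p q r = begin
    ℚ.∣ p ℚ.- r ∣
      ≡⟨ cong ℚ.∣_∣ (solve 3 (λ a b c → a :- c := (a :- b) :+ (b :- c)) refl p q r) ⟩
    ℚ.∣ (p ℚ.- q) ℚ.+ (q ℚ.- r) ∣
      ≤⟨ ℚ.∣p+q∣≤∣p∣+∣q∣ (p ℚ.- q) (q ℚ.- r) ⟩
    ℚ.∣ p ℚ.- q ∣ ℚ.+ ℚ.∣ q ℚ.- r ∣ ∎

  dist-neg : ∀ p q → ℚ.∣ ℚ.- p ℚ.- (ℚ.- q) ∣ ≡ ℚ.∣ p ℚ.- q ∣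
  dist-neg p q = trans (cong ℚ.∣_∣ (solve 2 (λ a b → :- a :- (:- b) := :- (a :- b)) refl p q))
                       (ℚ.∣-p∣≡∣p∣ (p ℚ.- q))

  ∣p∣-∣q∣≤∣p-q∣ : ∀ p q → ℚ.∣ p ∣ ℚ.- ℚ.∣ q ∣ ℚ.≤ ℚ.∣ p ℚ.- q ∣
  ∣p∣-∣q∣≤∣p-q∣ p q = begin
    ℚ.∣ p ∣ ℚ.- ℚ.∣ q ∣
      ≡⟨ cong (λ z → ℚ.∣ z ∣ ℚ.- ℚ.∣ q ∣) (solve 2 (λ a b → a := (a :- b) :+ b) refl p q) ⟩
    ℚ.∣ (p ℚ.- q) ℚ.+ q ∣ ℚ.- ℚ.∣ q ∣
      ≤⟨ ℚ.+-monoˡ-≤ (ℚ.- ℚ.∣ q ∣) (ℚ.∣p+q∣≤∣p∣+∣q∣ (p ℚ.- q) q) ⟩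
    (ℚ.∣ p ℚ.- q ∣ ℚ.+ ℚ.∣ q ∣) ℚ.- ℚ.∣ q ∣
      ≡⟨ solve 2 (λ a b → (a :+ b) :- b := a) refl (ℚ.∣ p ℚ.- q ∣) (ℚ.∣ q ∣) ⟩
    ℚ.∣ p ℚ.- q ∣ ∎

  dist-abs : ∀ p q → ℚ.∣ ℚ.∣ p ∣ ℚ.- ℚ.∣ q ∣ ∣ ℚ.≤ ℚ.∣ p ℚ.- q ∣
  dist-abs p q with ℚ.∣p∣≡p∨∣p∣≡-p (ℚ.∣ p ∣ ℚ.- ℚ.∣ q ∣)
  ... | inj₁ eq = subst (ℚ._≤ ℚ.∣ p ℚ.- q ∣) (sym eq) (∣p∣-∣q∣≤∣p-q∣ p q)
  ... | inj₂ eq = begin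
    ℚ.∣ ℚ.∣ p ∣ ℚ.- ℚ.∣ q ∣ ∣  ≡⟨ eq ⟩
    ℚ.- (ℚ.∣ p ∣ ℚ.- ℚ.∣ q ∣)
      ≡⟨ solve 2 (λ a b → :- (a :- b) := b :- a) refl (ℚ.∣ p ∣) (ℚ.∣ q ∣) ⟩
    ℚ.∣ q ∣ ℚ.- ℚ.∣ p ∣        ≤⟨ ∣p∣-∣q∣≤∣p-q∣ q p ⟩
    ℚ.∣ q ℚ.- p ∣              ≡⟨ dist-sym q p ⟩
    ℚ.∣ p ℚ.- q ∣              ∎

  dist-refl : ∀ {ε} p → 0ℚ ℚ.< ε → ℚ.∣ p ℚ.- p ∣ ℚ.< ε
  dist-refl {ε} p 0<ε = subst (λ z → ℚ.∣ z ∣ ℚ.< ε) (sym (ℚ.+-inverseʳ p)) 0<ε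

  <-halves : ∀ {ε p q r} → p ℚ.≤ q ℚ.+ r → q ℚ.< ½ ℚ.* ε → r ℚ.< ½ ℚ.* ε → p ℚ.< ε
  <-halves {ε} p≤q+r q< r< =
    ℚ.≤-<-trans p≤q+r (subst (_ ℚ.<_) (halves ε) (ℚ.+-mono-< q< r<))

open RationalLemmas

-- Real numbers are Cauchy sequences of rationals, with equality _≃_ meaning
-- that the difference of the two sequences tends to 0.

record ℝ : Set where
  constructor mkℝ
  field
    seq    : ℕ → ℚ
    cauchy : ∀ {ε} → 0ℚ ℚ.< ε →
             ∃ λ N → ∀ {m n} → N ℕ.≤ m → N ℕ.≤ n → ℚ.∣ seq m ℚ.- seq n ∣ ℚ.< ε

open ℝ public

infix 4 _≃_

record _≃_ (x y : ℝ) : Set where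
  constructor mk≃
  field
    close : ∀ {ε} → 0ℚ ℚ.< ε →
            ∃ λ N → ∀ {n} → N ℕ.≤ n → ℚ.∣ seq x n ℚ.- seq y n ∣ ℚ.< ε

open _≃_ public

fromℚ : ℚ → ℝ
fromℚ p = mkℝ (λ _ → p) λ 0<ε → 0 , λ _ _ → dist-refl p 0<ε

fromℕℝ : ℕ → ℝ
fromℕℝ n = fromℚ (ℤ.+ n ℚ./ 1)

0ℝ : ℝ
0ℝ = fromℚ 0ℚ

infixl 6 _+_ _-_
infix 8 -_

_+_ : ℝ → ℝ → ℝ
x + y = mkℝ (λ n → seq x n ℚ.+ seq y n) λ 0<ε →
  let M , p = cauchy x (half-pos 0<ε)
      N , q = cauchy y (half-pos 0<ε)
  in M ℕ.⊔ N , λ {m} {n} a b →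
       <-halves (dist-+ (seq x m) (seq y m) (seq x n) (seq y n))
                (p (ℕ.m⊔n≤o⇒m≤o M N a) (ℕ.m⊔n≤o⇒m≤o M N b))
                (q (ℕ.m⊔n≤o⇒n≤o M N a) (ℕ.m⊔n≤o⇒n≤o M N b))

-_ : ℝ → ℝ
- x = mkℝ (λ n → ℚ.- seq x n) λ {ε} 0<ε →
  let N , p = cauchy x 0<ε
  in N , λ {m} {n} a b →
       subst (ℚ._< ε) (sym (dist-neg (seq x m) (seq x n))) (p a b)

_-_ : ℝ → ℝ → ℝ
x - y = x + (- y)

∣_∣ : ℝ → ℝ
∣ x ∣ = mkℝ (λ n → ℚ.∣ seq x n ∣) λ 0<ε →
  let N , p = cauchy x 0<ε
  in N , λ {m} {n} a b → ℚ.≤-<-trans (dist-abs (seq x m) (seq x n)) (p a b)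

≃-isEquivalence : IsEquivalence _≃_
≃-isEquivalence = record
  { refl  = λ {x} → mk≃ λ 0<ε → 0 , λ {n} _ → dist-refl (seq x n) 0<ε
  ; sym   = λ {x} {y} x≃y → mk≃ λ {ε} 0<ε →
      let N , p = close x≃y 0<ε
      in N , λ {n} a → subst (ℚ._< ε) (dist-sym (seq x n) (seq y n)) (p a)
  ; trans = λ {x} {y} {z} x≃y y≃z → mk≃ λ 0<ε →
      let M , p = close x≃y (half-pos 0<ε)
          N , q = close y≃z (half-pos 0<ε)
      in M ℕ.⊔ N , λ {n} a →
           <-halves (dist-triangle (seq x n) (seq y n) (seq z n))
                    (p (ℕ.m⊔n≤o⇒m≤o M N a)) (q (ℕ.m⊔n≤o⇒n≤o M N a))
  }

+-cong : ∀ {x x′ y y′} → x ≃ x′ → y ≃ y′ → x + y ≃ x′ + y′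
+-cong {x} {x′} {y} {y′} x≃ y≃ = mk≃ λ 0<ε →
  let M , p = close x≃ (half-pos 0<ε)
      N , q = close y≃ (half-pos 0<ε)
  in M ℕ.⊔ N , λ {n} a →
       <-halves (dist-+ (seq x n) (seq y n) (seq x′ n) (seq y′ n))
                (p (ℕ.m⊔n≤o⇒m≤o M N a)) (q (ℕ.m⊔n≤o⇒n≤o M N a))

-‿cong : ∀ {x y} → x ≃ y → - x ≃ - y
-‿cong {x} {y} x≃y = mk≃ λ {ε} 0<ε →
  let N , p = close x≃y 0<ε
  in N , λ {n} a → subst (ℚ._< ε) (sym (dist-neg (seq x n) (seq y n))) (p a)

∣∣-cong : ∀ {x y} → x ≃ y → ∣ x ∣ ≃ ∣ y ∣
∣∣-cong {x} {y} x≃y = mk≃ λ 0<ε →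
  let N , p = close x≃y 0<ε
  in N , λ {n} a → ℚ.≤-<-trans (dist-abs (seq x n) (seq y n)) (p a)

ℝ^ : ℕ → Set
ℝ^ m = Vector ℝ m

infixl 6 _⊖_

_⊖_ : ∀ {m} → ℝ^ m → ℝ^ m → ℝ^ m
_⊖_ = zipWith _-_

‖_‖₁ : ∀ {m} → ℝ^ m → ℝ
‖ v ‖₁ = foldr _+_ 0ℝ (map ∣_∣ v)

-- Finite simple graph on the vertex set Fin n.
record Graph (n : ℕ) : Set₁ where
  field
    Adj    : Rel (Fin n) 0ℓ
    adj?   : Decidable Adj
    symm   : Symmetric Adj
    irrefl : Irreflexive _≡_ Adj

module _ {n : ℕ} (G : Graph n) where
  open Graph G

  data Walk : ℕ → Fin n → Fin n → Set where
    []  : ∀ {u} → Walk 0 u u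
    _∷_ : ∀ {k u v w} → Adj u v → Walk k v w → Walk (suc k) u w

  Connected : Set
  Connected = ∀ u v → ∃ λ k → Walk k u v

  -- A cycle with 3 + k distinct vertices.
  record Cycle (k : ℕ) : Set where
    field
      vertex   : Fin (3 ℕ.+ k) → Fin n
      distinct : Injective _≡_ _≡_ vertex
      step     : ∀ i → Adj (vertex (inject₁ i)) (vertex (suc i))
      closing  : Adj (vertex (fromℕ (2 ℕ.+ k))) (vertex zero)

  Acyclic : Set
  Acyclic = ∀ k → ¬ Cycle k

  walk? : ∀ k u v → Dec (Walk k u v)
  walk? zero    u v = map′ (λ { refl → [] }) (λ { [] → refl }) (u Fin.≟ v)
  walk? (suc k) u w = map′ (λ { (_ , e , p) → e ∷ p }) (λ { (e ∷ p) → _ , e , p })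
                           (any? λ v → adj? u v ×-dec walk? k v w)

record Tree (n : ℕ) : Set₁ where
  field
    graph     : Graph n
    nonEmpty  : ℕ.NonZero n
    connected : Connected graph
    acyclic   : Acyclic graph

IsLeast : (ℕ → Set) → ℕ → Set
IsLeast P d = P d × (∀ k → P k → d ℕ.≤ k)

least : ∀ {P : ℕ → Set} → U.Decidable P → ∀ m → P m → ∃ (IsLeast P)
least P? m Pm with P? 0
... | yes P0 = 0 , P0 , λ _ _ → z≤n
least P? zero    Pm | no ¬P0 = ⊥-elim (¬P0 Pm)
least P? (suc m) Pm | no ¬P0 with least (λ k → P? (suc k)) m Pm
... | d , Pd , d≤ = suc d , Pd , λ
  { zero    P0 → ⊥-elim (¬P0 P0)
  ; (suc k) Pk → s≤s (d≤ k Pk) }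

module _ {n : ℕ} (T : Tree n) where
  open Tree T

  shortest : ∀ u v → ∃ (IsLeast λ k → Walk graph k u v)
  shortest u v = let m , p = connected u v in least (λ k → walk? graph k u v) m p

  d : Fin n → Fin n → ℕ
  d u v = proj₁ (shortest u v)

-- A 2-element subset {i , j} is represented by its increasing enumeration i < j.
record V₂ (n : ℕ) : Set where
  constructor mkV₂
  field
    fst snd : Fin n
    fst<snd : fst Fin.< snd

module _ {n : ℕ} (T : Tree n) where

  min4 : (i j k l : Fin n) → ℕ
  min4 i j k l = (d T i l ℕ.+ d T j k) ℕ.⊓ ((d T i k ℕ.+ d T j l) ℕ.⊓ (d T i j ℕ.+ d T k l))

  Min4PC : V₂ n → V₂ n → ℕ
  Min4PC (mkV₂ i j _) (mkV₂ k l _) = min4 i j k l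

-- The choice of enumeration is immaterial: for distinct i , j and distinct
-- k , l, in any order, the entry at ({i , j} , {k , l}) is min4 i j k l.

⁅_,_⁆ : ∀ {n} (i j : Fin n) → i ≢ j → V₂ n
⁅ i , j ⁆ i≢j with <-cmp i j
... | tri< i<j _ _ = mkV₂ i j i<j
... | tri≈ _ i≡j _ = ⊥-elim (i≢j i≡j)
... | tri> _ _ j<i = mkV₂ j i j<i

module _ {n : ℕ} (T : Tree n) where
  open Tree T

  walk-snoc : ∀ {k u v w} → Walk graph k u v → Graph.Adj graph v w → Walk graph (suc k) u w
  walk-snoc []      f = f ∷ []
  walk-snoc (e ∷ p) f = e ∷ walk-snoc p f

  walk-reverse : ∀ {k u v} → Walk graph k u v → Walk graph k v u
  walk-reverse []      = []
  walk-reverse (e ∷ p) = walk-snoc (walk-reverse p) (Graph.symm graph e)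

  d-sym : ∀ u v → d T u v ≡ d T v u
  d-sym u v = ℕ.≤-antisym (half u v) (half v u)
    where
    half : ∀ u v → d T u v ℕ.≤ d T v u
    half u v = proj₂ (proj₂ (shortest T u v)) _
                     (walk-reverse (proj₁ (proj₂ (shortest T v u))))

  ⊓-swap : ∀ a b c → a ℕ.⊓ (b ℕ.⊓ c) ≡ b ℕ.⊓ (a ℕ.⊓ c)
  ⊓-swap a b c = trans (sym (ℕ.⊓-assoc a b c))
                (trans (cong (ℕ._⊓ c) (ℕ.⊓-comm a b)) (ℕ.⊓-assoc b a c))

  min4-swapˡ : ∀ i j k l → min4 T j i k l ≡ min4 T i j k l
  min4-swapˡ i j k l
    rewrite d-sym j i | ℕ.+-comm (d T j l) (d T i k) | ℕ.+-comm (d T j k) (d T i l)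
    = ⊓-swap (d T i k ℕ.+ d T j l) (d T i l ℕ.+ d T j k) (d T i j ℕ.+ d T k l)

  min4-swapʳ : ∀ i j k l → min4 T i j l k ≡ min4 T i j k l
  min4-swapʳ i j k l rewrite d-sym l k
    = ⊓-swap (d T i k ℕ.+ d T j l) (d T i l ℕ.+ d T j k) (d T i j ℕ.+ d T k l)

  Min4PC-entry : ∀ {i j k l} (i≢j : i ≢ j) (k≢l : k ≢ l) →
                 Min4PC T (⁅ i , j ⁆ i≢j) (⁅ k , l ⁆ k≢l) ≡ min4 T i j k l
  Min4PC-entry {i} {j} {k} {l} i≢j k≢l with <-cmp i j | <-cmp k l
  ... | tri≈ _ i≡j _ | _            = ⊥-elim (i≢j i≡j)
  ... | tri< _ _ _   | tri≈ _ k≡l _ = ⊥-elim (k≢l k≡l)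
  ... | tri> _ _ _   | tri≈ _ k≡l _ = ⊥-elim (k≢l k≡l)
  ... | tri< _ _ _   | tri< _ _ _   = refl
  ... | tri< _ _ _   | tri> _ _ _   = min4-swapʳ i j k l
  ... | tri> _ _ _   | tri< _ _ _   = min4-swapˡ i j k l
  ... | tri> _ _ _   | tri> _ _ _   = trans (min4-swapʳ j i k l) (min4-swapˡ i j k l)

Isometrically-ℓ₁-Embeddable : ∀ {A : Set} → (A → A → ℕ) → ℕ → Set
Isometrically-ℓ₁-Embeddable {A} D m =
  ∃ λ (φ : A → ℝ^ m) → ∀ p q → fromℕℝ (D p q) ≃ ‖ φ p ⊖ φ q ‖₁

{-# OPTIONS --safe #-}

-- Every edge of T cuts the vertex set in two; let φ {i , j} be the indicator
-- vector of the edges separating i from j.  For four vertices i, j, k, l, an edge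
-- that splits them 1-3 contributes 1 to each of the three sums of distances and
-- 1 to ‖ φ {i , j} - φ {k , l} ‖₁; an edge that splits them 2-2 contributes 0 to
-- one of the sums, 2 to the other two, and 0 to the norm.  The cuts of a tree do
-- not cross, so all 2-2 splits agree, and the sum they do not contribute to is
-- both the minimum and the norm.
--
-- With vertex zero as root, the n - 1 edges are indexed by their lower endpoints
-- suc k, and the cut of edge k is the set of descendants of suc k.

module Submission where

open import Defs
open import Algebra.Bundles using (CommutativeMonoid; CommutativeRing)
import Algebra.Properties.CommutativeMonoid.Sum as Sum
import Algebra.Properties.CommutativeSemigroup as CommSemigroup
open import Data.Bool.Base using (Bool; true; false; if_then_else_; _xor_)
import Data.Bool.Properties as Bool
open import Data.Empty using (⊥; ⊥-elim)
open import Data.Fin.Base as Fin using (Fin; zero; suc; inject₁; fromℕ)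
open import Data.Fin.Properties as Fin using (any?)
import Data.Integer.Base as ℤ
import Data.Integer.Properties as ℤ
open import Data.Nat.Base using (ℕ; _∸_)
open import Data.Nat.Base as ℕ using (zero; suc; z≤n; s≤s; _≤_; _<_; _⊓_)
open import Data.Nat.Induction using (<-wellFounded)
import Data.Nat.Properties as ℕ
open import Data.Product.Base using (∃; _×_; _,_; proj₁; proj₂)
import Data.Rational.Base as ℚ
import Data.Rational.Properties as ℚ
open import Data.Rational.Unnormalised.Base as ℚᵘ using (*≡*)
import Data.Rational.Unnormalised.Properties as ℚᵘ
open import Data.Sum.Base using (_⊎_; inj₁; inj₂; swap; [_,_]′)
open import Data.Vec.Functional using (Vector)
open import Function.Base using (_∘_)
open import Function.Bundles using (mk⇔)
open import Function.Definitions using (Injective)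
open import Induction.WellFounded using (Acc; acc)
open import Relation.Binary.PropositionalEquality
open import Relation.Nullary using (¬_; Dec; yes; no; does; contradiction)
open import Relation.Nullary.Decidable using (map′; _×-dec_; _⊎-dec_; does-⇔; dec-true; dec-false)

open Sum ℕ.+-0-commutativeMonoid using (sum; sum-cong-≗; ∑-distrib-+)

-- Finite sums and minima of natural numbers.

sum-mono-≤ : ∀ {m} {f g : Vector ℕ m} → (∀ l → f l ≤ g l) → sum f ≤ sum g
sum-mono-≤ {zero}  f≤g = z≤n
sum-mono-≤ {suc m} f≤g = ℕ.+-mono-≤ (f≤g zero) (sum-mono-≤ (f≤g ∘ suc))

sum-zero : ∀ {m} {f : Vector ℕ m} → (∀ l → f l ≡ 0) → sum f ≡ 0
sum-zero {zero}  f≡0 = refl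
sum-zero {suc m} f≡0 = cong₂ ℕ._+_ (f≡0 zero) (sum-zero (f≡0 ∘ suc))

-- Crossing a tree edge changes a single coordinate `k`; the offsets `a` and `b` record a gain or
-- loss of 1 there.
sum-mono-≤-except : ∀ {m} {f g : Vector ℕ m} k a b → (∀ l → l ≢ k → f l ≤ g l) →
                    a ℕ.+ f k ≤ b ℕ.+ g k → a ℕ.+ sum f ≤ b ℕ.+ sum g
sum-mono-≤-except {suc m} {f} {g} zero a b f≤g k≤ = begin
  a ℕ.+ (f zero ℕ.+ _)  ≡⟨ ℕ.+-assoc a (f zero) _ ⟨
  a ℕ.+ f zero ℕ.+ _    ≤⟨ ℕ.+-mono-≤ k≤ (sum-mono-≤ λ l → f≤g (suc l) λ ()) ⟩
  b ℕ.+ g zero ℕ.+ _    ≡⟨ ℕ.+-assoc b (g zero) _ ⟩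
  b ℕ.+ (g zero ℕ.+ _)  ∎
  where open ℕ.≤-Reasoning
sum-mono-≤-except {suc m} {f} {g} (suc k) a b f≤g k≤ = begin
  a ℕ.+ (f zero ℕ.+ _)  ≡⟨ x∙yz≈y∙xz a (f zero) _ ⟩
  f zero ℕ.+ (a ℕ.+ _)  ≤⟨ ℕ.+-mono-≤ (f≤g zero λ ()) (sum-mono-≤-except k a b
                             (λ l l≢k → f≤g (suc l) (l≢k ∘ Fin.suc-injective)) k≤) ⟩
  g zero ℕ.+ (b ℕ.+ _)  ≡⟨ x∙yz≈y∙xz (g zero) b _ ⟩
  b ℕ.+ (g zero ℕ.+ _)  ∎
  where
  open ℕ.≤-Reasoning
  open CommSemigroup ℕ.+-commutativeSemigroup using (x∙yz≈y∙xz)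

⊓₃-unique : ∀ {x a b c} → x ≤ a → x ≤ b → x ≤ c →
            a ≡ x ⊎ b ≡ x ⊎ c ≡ x → a ⊓ (b ⊓ c) ≡ x
⊓₃-unique {x} {a} {b} {c} x≤a x≤b x≤c attained =
  ℕ.≤-antisym (upper attained) (ℕ.⊓-glb x≤a (ℕ.⊓-glb x≤b x≤c))
  where
  upper : a ≡ x ⊎ b ≡ x ⊎ c ≡ x → a ⊓ (b ⊓ c) ≤ x
  upper (inj₁ refl)        = ℕ.m⊓n≤m a (b ⊓ c)
  upper (inj₂ (inj₁ refl)) = ℕ.≤-trans (ℕ.m⊓n≤n a (b ⊓ c)) (ℕ.m⊓n≤m b c)
  upper (inj₂ (inj₂ refl)) = ℕ.≤-trans (ℕ.m⊓n≤n a (b ⊓ c)) (ℕ.m⊓n≤n b c)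

-- Boolean vectors and Hamming distance.

weight : Bool → ℕ
weight b = if b then 1 else 0

weight≤1 : ∀ b → weight b ≤ 1
weight≤1 false = z≤n
weight≤1 true  = s≤s z≤n

weight-xor-≤ : ∀ a b → weight (a xor b) ≤ weight a ℕ.+ weight b
weight-xor-≤ false b     = ℕ.≤-refl
weight-xor-≤ true  false = s≤s z≤n
weight-xor-≤ true  true  = z≤n

weight-xor-≡ : ∀ a b → ¬ (a ≡ true × b ≡ true) → weight a ℕ.+ weight b ≡ weight (a xor b)
weight-xor-≡ false b     ¬both = refl
weight-xor-≡ true  false ¬both = refl
weight-xor-≡ true  true  ¬both = contradiction (refl , refl) ¬both

xor-true⇒≢ : ∀ {a b} → a xor b ≡ true → a ≢ b
xor-true⇒≢ {a} eq refl with () ← trans (sym (Bool.xor-same a)) eq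

xor-interchange : ∀ a b c e → (a xor b) xor (c xor e) ≡ (a xor c) xor (b xor e)
xor-interchange = interchange
  where
  open CommutativeRing Bool.xor-∧-commutativeRing using (+-commutativeMonoid)
  open CommSemigroup (CommutativeMonoid.commutativeSemigroup +-commutativeMonoid) using (interchange)

hamming : ∀ {m} → Vector Bool m → Vector Bool m → ℕ
hamming f g = sum λ l → weight (f l xor g l)

hamming-refl : ∀ {m} (f : Vector Bool m) → hamming f f ≡ 0
hamming-refl f = sum-zero λ l → cong weight (Bool.xor-same (f l))

hamming-sym : ∀ {m} (f g : Vector Bool m) → hamming f g ≡ hamming g f
hamming-sym f g = sum-cong-≗ λ l → cong weight (Bool.xor-comm (f l) (g l))

-- Four points in a laminar family of sets.

-- `laminar` makes two members with a common point `x` nested: `y` and `z` would show that neither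
-- contains the other.
module FourPoints {V : Set} {m} (S : Fin m → V → Bool)
  (laminar : ∀ u v x y z → S u x ≡ true → S v x ≡ true →
             S u y ≡ false → S v y ≡ true → S u z ≡ true → S v z ≡ false → ⊥)
  where

  at : V → Vector Bool m
  at x k = S k x

  private
    bothSides : ∀ u v {a b s} → S v a ≡ s → S v b ≡ s → S u a ≢ S u b →
                (∃ λ x → S u x ≡ true × S v x ≡ s) × (∃ λ y → S u y ≡ false × S v y ≡ s)
    bothSides u v {a} {b} va vb a≢b with S u a in ua | S u b in ub
    ... | true  | true  = contradiction refl a≢b
    ... | true  | false = (a , ua , va) , (b , ub , vb)
    ... | false | true  = (b , ub , vb) , (a , ua , va)
    ... | false | false = contradiction refl a≢b

    -- Here `u` splits a pair inside `v` and a pair outside `v`, so there are points in both sets,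
    -- in `v` only and in `u` only.
    crossing′ : ∀ u v {a b c e} → S v a ≡ true → S v c ≡ true → S v b ≡ false → S v e ≡ false →
                S u a ≢ S u c → S u b ≢ S u e → ⊥
    crossing′ u v va vc vb ve a≢c b≢e
      with (x , ux , vx) , (y , uy , vy) ← bothSides u v va vc a≢c
         | (z , uz , vz) , _ ← bothSides u v vb ve b≢e
      = laminar u v x y z ux vx uy vy uz vz

    -- `v` has `a`, `c` on one side and `b`, `e` on the other; exchanging the two pairs if necessary
    -- puts `a`, `c` inside `v`.
    crossing : ∀ u v {a b c e} → S v a ≢ S v b → S v c ≢ S v e → S v a ≡ S v c →
               S u a ≢ S u c → S u b ≢ S u e → ⊥
    crossing u v {a} {b} {c} {e} va≢vb vc≢ve va≡vc a≢c b≢e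
      with S v a in va | S v b in vb | S v c in vc | S v e in ve
    ... | true  | true  | _     | _     = va≢vb refl
    ... | false | false | _     | _     = va≢vb refl
    ... | _     | _     | true  | true  = vc≢ve refl
    ... | _     | _     | false | false = vc≢ve refl
    ... | true  | false | true  | false = crossing′ u v va vc vb ve a≢c b≢e
    ... | false | true  | false | true  = crossing′ u v vb ve va vc b≢e a≢c
    ... | true  | false | false | true  with () ← va≡vc
    ... | false | true  | true  | false with () ← va≡vc

  Separates : V → V → V → V → Fin m → Set
  Separates a b c e k = S k a xor S k b ≡ true × S k c xor S k e ≡ true

  -- A cut `v` separating both `i` from `j` and `k` from `l` groups `i` with `k` or with `l`. No
  -- other cut can split both groups without crossing `v`, so this grouping is the wanted pairing.
  unseparated : ∀ i j k l → (∀ u → ¬ Separates i l j k u) ⊎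
                            (∀ u → ¬ Separates i k j l u) ⊎
                            (∀ u → ¬ Separates i j k l u)
  unseparated i j k l
    with any? (λ v → (S v i xor S v j Bool.≟ true) ×-dec (S v k xor S v l Bool.≟ true))
  ... | no none = inj₂ (inj₂ λ u sep → none (u , sep))
  ... | yes (v , ij , kl) with S v i Bool.≟ S v k
  ...   | yes i≡k = inj₂ (inj₁ λ u (ik , jl) →
            crossing u v (xor-true⇒≢ ij) (xor-true⇒≢ kl) i≡k (xor-true⇒≢ ik) (xor-true⇒≢ jl))
  -- At `v` both `i` and `l` differ from `k`, and with only two values they agree.
  ...   | no  i≢k = inj₁ λ u (il , jk) →
            crossing u v (xor-true⇒≢ ij) (≢-sym (xor-true⇒≢ kl))
              (trans (Bool.¬-not i≢k) (sym (Bool.¬-not (≢-sym (xor-true⇒≢ kl)))))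
              (xor-true⇒≢ il) (xor-true⇒≢ jk)

  -- Counts the cuts with an odd number of the four points on each side, hence the 1-3 splits; this
  -- is independent of how the points are paired.
  parity : V → V → V → V → ℕ
  parity a b c e = sum λ u → weight ((S u a xor S u b) xor (S u c xor S u e))

  parity-≤ : ∀ a b c e → parity a b c e ≤ hamming (at a) (at b) ℕ.+ hamming (at c) (at e)
  parity-≤ a b c e = subst (parity a b c e ≤_)
    (∑-distrib-+ (λ u → weight (S u a xor S u b)) (λ u → weight (S u c xor S u e)))
    (sum-mono-≤ λ u → weight-xor-≤ (S u a xor S u b) (S u c xor S u e))

  -- Sum and `xor` of two bits differ only where both are `true`, that is, at a cut separating both
  -- pairs.
  parity-≡ : ∀ a b c e → (∀ u → ¬ Separates a b c e u) →
             hamming (at a) (at b) ℕ.+ hamming (at c) (at e) ≡ parity a b c e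
  parity-≡ a b c e unsep = trans
    (sym (∑-distrib-+ (λ u → weight (S u a xor S u b)) (λ u → weight (S u c xor S u e))))
    (sum-cong-≗ λ u → weight-xor-≡ (S u a xor S u b) (S u c xor S u e) (unsep u))

  parity-swap : ∀ a b c e → parity a c b e ≡ parity a b c e
  parity-swap a b c e = sum-cong-≗ λ u →
    cong weight (xor-interchange (S u a) (S u c) (S u b) (S u e))

  parity-comm : ∀ a b c e → parity a b e c ≡ parity a b c e
  parity-comm a b c e = sum-cong-≗ λ u →
    cong (λ s → weight ((S u a xor S u b) xor s)) (Bool.xor-comm (S u e) (S u c))

  parity-rotate : ∀ i j k l → parity i l j k ≡ parity i j k l
  parity-rotate i j k l = trans (parity-swap i j l k) (parity-comm i j k l)

  -- `parity` is a lower bound for all three sums, and the pairing found by `unseparated` attains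
  -- it.
  min-hamming : ∀ i j k l →
    (hamming (at i) (at l) ℕ.+ hamming (at j) (at k)) ⊓
      ((hamming (at i) (at k) ℕ.+ hamming (at j) (at l)) ⊓
       (hamming (at i) (at j) ℕ.+ hamming (at k) (at l)))
    ≡ parity i j k l
  min-hamming i j k l = ⊓₃-unique
    (ℕ.≤-trans (ℕ.≤-reflexive (sym (parity-rotate i j k l))) (parity-≤ i l j k))
    (ℕ.≤-trans (ℕ.≤-reflexive (sym (parity-swap i j k l))) (parity-≤ i k j l))
    (parity-≤ i j k l)
    (attained (unseparated i j k l))
    where
    attained : _ → _
    attained (inj₁ unsep)        = inj₁ (trans (parity-≡ i l j k unsep) (parity-rotate i j k l))
    attained (inj₂ (inj₁ unsep)) = inj₂ (inj₁ (trans (parity-≡ i k j l unsep) (parity-swap i j k l)))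
    attained (inj₂ (inj₂ unsep)) = inj₂ (inj₂ (parity-≡ i j k l unsep))

-- Simple walks and spanning subgraphs.

module _ {n : ℕ} {G : Graph n} where
  open Graph G

  vertexAt : ∀ {k u w} → Walk G k u w → Fin (suc k) → Fin n
  vertexAt {u = u} []      _       = u
  vertexAt {u = u} (e ∷ p) zero    = u
  vertexAt         (e ∷ p) (suc i) = vertexAt p i

  Simple : ∀ {k u w} → Walk G k u w → Set
  Simple p = Injective _≡_ _≡_ (vertexAt p)

  vertexAt-zero : ∀ {k u w} (p : Walk G k u w) → vertexAt p zero ≡ u
  vertexAt-zero []      = refl
  vertexAt-zero (e ∷ p) = refl

  vertexAt-last : ∀ {k u w} (p : Walk G k u w) → vertexAt p (fromℕ k) ≡ w
  vertexAt-last []      = refl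
  vertexAt-last (e ∷ p) = vertexAt-last p

  vertexAt-step : ∀ {k u w} (p : Walk G k u w) (i : Fin k) →
                  Adj (vertexAt p (inject₁ i)) (vertexAt p (suc i))
  vertexAt-step (e ∷ p) zero    = subst (Adj _) (sym (vertexAt-zero p)) e
  vertexAt-step (e ∷ p) (suc i) = vertexAt-step p i

  simple-suffix : ∀ {k u w} (p : Walk G k u w) → Simple p → ∀ i →
                  ∃ λ l → ∃ λ (q : Walk G l (vertexAt p i) w) → Simple q
  simple-suffix []      simple i       = _ , [] , simple
  simple-suffix (e ∷ p) simple zero    = _ , e ∷ p , simple
  simple-suffix (e ∷ p) simple (suc i) = simple-suffix p (Fin.suc-injective ∘ simple) i

  simplify : ∀ {k u w} → Walk G k u w → ∃ λ l → ∃ λ (q : Walk G l u w) → Simple q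
  simplify [] = 0 , [] , λ { {zero} {zero} _ → refl }
  simplify {u = u} (e ∷ p) with simplify p
  ... | l , q , simple with any? (λ i → vertexAt q i Fin.≟ u)
  -- `u` recurs on the simplified rest, so the detour before that occurrence is dropped.
  ...   | yes (i , refl) = simple-suffix q simple i
  ...   | no  u∉q = suc l , e ∷ q , λ
    { {zero}  {zero}  _  → refl
    ; {zero}  {suc j} eq → contradiction (j , sym eq) u∉q
    ; {suc i} {zero}  eq → contradiction (i , eq) u∉q
    ; {suc i} {suc j} eq → cong suc (simple eq) }

  walk-++ : ∀ {k l u v w} → Walk G k u v → Walk G l v w → Walk G (k ℕ.+ l) u w
  walk-++ []      q = q
  walk-++ (e ∷ p) q = e ∷ walk-++ p q

  walk-∷ʳ : ∀ {k u v w} → Walk G k u v → Adj v w → Walk G (suc k) u w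
  walk-∷ʳ []      f = f ∷ []
  walk-∷ʳ (e ∷ p) f = e ∷ walk-∷ʳ p f

  reverse : ∀ {k u v} → Walk G k u v → Walk G k v u
  reverse []      = []
  reverse (e ∷ p) = walk-∷ʳ (reverse p) (symm e)

-- An edge outside H would close a cycle with a simple walk in H.
acyclic⇒spanning : ∀ {n} {G H : Graph n} → Acyclic G → Connected H →
  (∀ {u v} → Graph.Adj H u v → Graph.Adj G u v) →
  ∀ {x y} → Graph.Adj G x y → Graph.Adj H x y
acyclic⇒spanning {G = G} acyclic connected H⊆G {x} {y} xy
  with simplify (proj₂ (connected x y))
... | _ , [] , _     = contradiction xy (Graph.irrefl G refl)
... | _ , e ∷ [] , _ = e
... | suc (suc k) , p@(_ ∷ (_ ∷ _)) , simple = ⊥-elim (acyclic k record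
  { vertex   = vertexAt p
  ; distinct = simple
  ; step     = H⊆G ∘ vertexAt-step p
  ; closing  = subst (λ v → Graph.Adj G v x) (sym (vertexAt-last p)) (Graph.symm G xy)
  })

-- Rooted trees, the ancestor order and edge cuts.

module Rooted {m : ℕ} (parent : Fin m → Fin (suc m)) (height : Fin (suc m) → ℕ)
  (parent< : ∀ k → height (parent k) < height (suc k)) where

  infix 4 _≼_ _≼?_ _◁_

  data _◁_ : Fin (suc m) → Fin (suc m) → Set where
    edge : ∀ k → parent k ◁ suc k

  _◁?_ : ∀ u v → Dec (u ◁ v)
  u ◁? zero  = no λ ()
  u ◁? suc k = map′ (λ { refl → edge k }) (λ { (edge _) → refl }) (u Fin.≟ parent k)

  -- The ancestor order: climbing from the index to its parents reaches `v`. The vertices above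
  -- `suc k` in this order form the subtree hanging from edge `k`.
  data _≼_ (v : Fin (suc m)) : Fin (suc m) → Set where
    here  : v ≼ v
    above : ∀ {k} → v ≼ parent k → v ≼ suc k

  ≼-trans : ∀ {u v w} → u ≼ v → v ≼ w → u ≼ w
  ≼-trans p here      = p
  ≼-trans p (above q) = above (≼-trans p q)

  -- Each vertex has at most one parent, so the ancestors of `x` lie on a single upward path.
  ≼-linear : ∀ {u v x} → u ≼ x → v ≼ x → u ≼ v ⊎ v ≼ u
  ≼-linear here      q         = inj₂ q
  ≼-linear p         here      = inj₁ p
  ≼-linear (above p) (above q) = ≼-linear p q

  ≼⇒height≤ : ∀ {u v} → u ≼ v → height u ≤ height v
  ≼⇒height≤ here          = ℕ.≤-refl
  ≼⇒height≤ (above {k} p) = ℕ.≤-trans (≼⇒height≤ p) (ℕ.<⇒≤ (parent< k))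

  suc⋠parent : ∀ k → ¬ suc k ≼ parent k
  suc⋠parent k p = ℕ.<⇒≱ (parent< k) (≼⇒height≤ p)

  ≼-antisym : ∀ {u v} → u ≼ v → v ≼ u → u ≡ v
  ≼-antisym here          q = refl
  ≼-antisym (above {k} p) q = contradiction (≼-trans q p) (suc⋠parent k)

  ≼⇒parent : ∀ {v k} → v ≢ suc k → v ≼ suc k → v ≼ parent k
  ≼⇒parent v≢ here      = contradiction refl v≢
  ≼⇒parent v≢ (above p) = p

  -- `parent k` need not be a smaller index than `suc k`, so the recursion is on `height`.
  parent-induction : (P : Fin (suc m) → Set) → P zero → (∀ k → P (parent k) → P (suc k)) → ∀ x → P x
  parent-induction P base step x = go x (<-wellFounded (height x))
    where
    go : ∀ x → Acc _<_ (height x) → P x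
    go zero    _        = base
    go (suc k) (acc rs) = step k (go (parent k) (rs (parent< k)))

  abstract
    -- Kept abstract so that `cut` does not unfold into the well-founded recursion.
    _≼?_ : ∀ v x → Dec (v ≼ x)
    v ≼? x = parent-induction (λ x → Dec (v ≼ x))
      (map′ (λ { refl → here }) (λ { here → refl }) (v Fin.≟ zero))
      (λ k below? → map′ [ (λ { refl → here }) , above ]′
                         (λ { here → inj₁ refl ; (above p) → inj₂ p })
                         (v Fin.≟ suc k ⊎-dec below?))
      x

  cut : Fin m → Fin (suc m) → Bool
  cut k x = does (suc k ≼? x)

  cut-true : ∀ k x → cut k x ≡ true → suc k ≼ x
  cut-true k x eq with yes p ← suc k ≼? x = p

  cut-false : ∀ k x → cut k x ≡ false → ¬ suc k ≼ x
  cut-false k x eq with no ¬p ← suc k ≼? x = ¬p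

  -- The roots of two subtrees containing `x` are both ancestors of `x`, hence comparable, and the
  -- subtrees are nested.
  cut-laminar : ∀ u v x y z → cut u x ≡ true → cut v x ≡ true →
                cut u y ≡ false → cut v y ≡ true → cut u z ≡ true → cut v z ≡ false → ⊥
  cut-laminar u v x y z ux vx uy vy uz vz with ≼-linear (cut-true u x ux) (cut-true v x vx)
  ... | inj₁ u≼v = cut-false u y uy (≼-trans u≼v (cut-true v y vy))
  ... | inj₂ v≼u = cut-false v z vz (≼-trans v≼u (cut-true u z uz))

  cut-parent : ∀ {l k} → l ≢ k → cut l (suc k) ≡ cut l (parent k)
  cut-parent {l} {k} l≢k = does-⇔ (mk⇔ (≼⇒parent (l≢k ∘ Fin.suc-injective)) above)
                                  (suc l ≼? suc k) (suc l ≼? parent k)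

  open FourPoints cut cut-laminar public

  dist : Fin (suc m) → Fin (suc m) → ℕ
  dist x y = hamming (at x) (at y)

  private
    at-parent : ∀ k z l → l ≢ k →
                weight (cut l (suc k) xor cut l z) ≡ weight (cut l (parent k) xor cut l z)
    at-parent k z l l≢k = cong (λ s → weight (s xor cut l z)) (cut-parent l≢k)

  dist-◁-≤ : ∀ {x y} z → x ◁ y ⊎ y ◁ x → dist x z ≤ suc (dist y z)
  dist-◁-≤ z (inj₁ (edge k)) = sum-mono-≤-except k 0 1
    (λ l l≢k → ℕ.≤-reflexive (sym (at-parent k z l l≢k))) (ℕ.≤-trans (weight≤1 _) (ℕ.m≤m+n 1 _))
  dist-◁-≤ z (inj₂ (edge k)) = sum-mono-≤-except k 0 1
    (λ l l≢k → ℕ.≤-reflexive (at-parent k z l l≢k)) (ℕ.≤-trans (weight≤1 _) (ℕ.m≤m+n 1 _))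

  -- With `z` outside the subtree of `suc k`, edge `k` separates `z` from `suc k` but not from
  -- `parent k`; every other cut treats the two ends alike.
  dist-parent-< : ∀ k z → ¬ suc k ≼ z → dist (parent k) z < dist (suc k) z
  dist-parent-< k z k⋠z = sum-mono-≤-except k 1 0
    (λ l l≢k → ℕ.≤-reflexive (sym (at-parent k z l l≢k)))
    at-k
    where
    at-k : suc (weight (cut k (parent k) xor cut k z)) ≤ weight (cut k (suc k) xor cut k z)
    at-k rewrite dec-false (suc k ≼? parent k) (suc⋠parent k)
               | dec-false (suc k ≼? z) k⋠z
               | dec-true (suc k ≼? suc k) here = ℕ.≤-refl

  -- Supplies a vertex that has a parent and is no ancestor of the other, so that climbing from it
  -- brings the two closer.
  ≢⇒⋠ : ∀ x y → x ≢ y → (∃ λ k → x ≡ suc k × ¬ x ≼ y) ⊎ (∃ λ k → y ≡ suc k × ¬ y ≼ x)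
  ≢⇒⋠ zero    zero    x≢y = contradiction refl x≢y
  ≢⇒⋠ zero    (suc k) x≢y = inj₂ (k , refl , λ ())
  ≢⇒⋠ (suc k) zero    x≢y = inj₁ (k , refl , λ ())
  ≢⇒⋠ (suc k) (suc l) x≢y with suc k ≼? suc l
  ... | no  k⋠l = inj₁ (k , refl , k⋠l)
  ... | yes k≼l = inj₂ (l , refl , λ l≼k → x≢y (≼-antisym k≼l l≼k))

-- Tree distance as the number of separating cuts.

module Distances {m : ℕ} (T : Tree (suc m)) where
  open Tree T
  open Graph graph

  d-walk : ∀ {k u v} → Walk graph k u v → d T u v ≤ k
  d-walk {u = u} {v} = proj₂ (proj₂ (shortest T u v)) _

  d-refl : ∀ u → d T u u ≡ 0
  d-refl u = ℕ.n≤0⇒n≡0 (d-walk {u = u} [])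

  d-step : ∀ {u v} w → Adj u v → d T u w ≤ suc (d T v w)
  d-step {v = v} w e = d-walk (e ∷ proj₁ (proj₂ (shortest T v w)))

  towardsRoot : ∀ k → ∃ λ v → Adj (suc k) v × d T v zero < d T (suc k) zero
  towardsRoot k with shortest T (suc k) zero
  -- The parent is the second vertex of a shortest walk to the root, which is nonempty because
  -- `suc k` is not `zero`.
  ... | _ , e ∷ p , _ = _ , e , s≤s (d-walk p)

  parent : Fin m → Fin (suc m)
  parent k = proj₁ (towardsRoot k)

  parent-adj : ∀ k → Adj (suc k) (parent k)
  parent-adj k = proj₁ (proj₂ (towardsRoot k))

  open Rooted parent (λ v → d T v zero) (λ k → proj₂ (proj₂ (towardsRoot k))) public

  ◁⇒adj : ∀ {u v} → u ◁ v ⊎ v ◁ u → Adj u v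
  ◁⇒adj (inj₁ (edge k)) = symm (parent-adj k)
  ◁⇒adj (inj₂ (edge k)) = parent-adj k

  parentGraph : Graph (suc m)
  parentGraph = record
    { Adj    = λ u v → u ◁ v ⊎ v ◁ u
    ; adj?   = λ u v → (u ◁? v) ⊎-dec (v ◁? u)
    ; symm   = swap
    ; irrefl = λ u≡v e → irrefl u≡v (◁⇒adj e)
    }

  parentGraph-connected : Connected parentGraph
  parentGraph-connected u v =
    let _ , p = toRoot u
        _ , q = toRoot v
    in _ , walk-++ p (reverse q)
    where
    toRoot : ∀ x → ∃ λ k → Walk parentGraph k x zero
    toRoot = parent-induction _ (0 , []) λ k (l , p) → suc l , inj₂ (edge k) ∷ p

  -- The parent edges already connect all vertices, so any further edge of `T` would close a cycle.
  adj⇒◁ : ∀ {u v} → Adj u v → u ◁ v ⊎ v ◁ u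
  adj⇒◁ = acyclic⇒spanning acyclic parentGraph-connected ◁⇒adj

  dist-walk : ∀ {k x y} → Walk graph k x y → dist x y ≤ k
  dist-walk {x = x}         []      = ℕ.≤-reflexive (hamming-refl (at x))
  dist-walk {x = x} {y = y} (e ∷ p) =
    ℕ.≤-trans (dist-◁-≤ y (adj⇒◁ e)) (s≤s (dist-walk p))

  dist-sym : ∀ x y → dist x y ≡ dist y x
  dist-sym x y = hamming-sym (at x) (at y)

  -- Induction on `N`: while `x` and `y` differ, one of them climbs to its parent, which costs one
  -- edge and lowers `dist`.
  dist≤⇒d≤ : ∀ N x y → dist x y ≤ N → d T x y ≤ N

  private
    d≤-climb : ∀ N k y → ¬ suc k ≼ y → dist (suc k) y ≤ N → d T (suc k) y ≤ N
    d≤-climb zero k y k⋠y bound =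
      contradiction (ℕ.<-≤-trans (dist-parent-< k y k⋠y) bound) λ ()
    d≤-climb (suc N) k y k⋠y bound = ℕ.≤-trans (d-step y (parent-adj k))
      (s≤s (dist≤⇒d≤ N (parent k) y (ℕ.≤-pred (ℕ.<-≤-trans (dist-parent-< k y k⋠y) bound))))

  dist≤⇒d≤ N x y bound = compare (x Fin.≟ y)
    where
    compare : Dec (x ≡ y) → d T x y ≤ N
    compare (yes refl) = ℕ.≤-trans (ℕ.≤-reflexive (d-refl x)) z≤n
    compare (no  x≢y) with ≢⇒⋠ x y x≢y
    ... | inj₁ (k , refl , k⋠y) = d≤-climb N k y k⋠y bound
    ... | inj₂ (k , refl , k⋠x) = subst (_≤ N) (d-sym T y x)
            (d≤-climb N k x k⋠x (subst (_≤ N) (dist-sym x y) bound))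

  d≡dist : ∀ x y → d T x y ≡ dist x y
  d≡dist x y = ℕ.≤-antisym (dist≤⇒d≤ _ x y ℕ.≤-refl)
                           (dist-walk (proj₁ (proj₂ (shortest T x y))))

  min4≡parity : ∀ i j k l → min4 T i j k l ≡ parity i j k l
  min4≡parity i j k l
    rewrite d≡dist i l | d≡dist j k | d≡dist i k | d≡dist j l | d≡dist i j | d≡dist k l
    = min-hamming i j k l

-- Integer-valued vectors over the reals and the embedding.

-- Unnormalised rationals avoid reduction to lowest terms, leaving an identity of integers.
/1-homo-+ : ∀ a b → ℤ.+ (a ℕ.+ b) ℚ./ 1 ≡ ℤ.+ a ℚ./ 1 ℚ.+ ℤ.+ b ℚ./ 1
/1-homo-+ a b = ℚ.toℚᵘ-injective (begin
  ℚ.toℚᵘ (ℤ.+ (a ℕ.+ b) ℚ./ 1)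
    ≈⟨ ℚ.toℚᵘ-fromℚᵘ (ℤ.+ (a ℕ.+ b) ℚᵘ./ 1) ⟩
  ℤ.+ (a ℕ.+ b) ℚᵘ./ 1
    ≈⟨ *≡* (cong (ℤ._* ℤ.+ 1) (cong₂ ℤ._+_ (ℤ.*-identityʳ (ℤ.+ a)) (ℤ.*-identityʳ (ℤ.+ b)))) ⟨
  ℤ.+ a ℚᵘ./ 1 ℚᵘ.+ ℤ.+ b ℚᵘ./ 1
    ≈⟨ ℚᵘ.+-cong (ℚ.toℚᵘ-fromℚᵘ (ℤ.+ a ℚᵘ./ 1)) (ℚ.toℚᵘ-fromℚᵘ (ℤ.+ b ℚᵘ./ 1)) ⟨
  ℚ.toℚᵘ (ℤ.+ a ℚ./ 1) ℚᵘ.+ ℚ.toℚᵘ (ℤ.+ b ℚ./ 1)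
    ≈⟨ ℚ.toℚᵘ-homo-+ (ℤ.+ a ℚ./ 1) (ℤ.+ b ℚ./ 1) ⟨
  ℚ.toℚᵘ (ℤ.+ a ℚ./ 1 ℚ.+ ℤ.+ b ℚ./ 1) ∎)
  where open ℚᵘ.≃-Reasoning

indicator : ∀ {m} → Vector Bool m → ℝ^ m
indicator f k = fromℕℝ (weight (f k))

∣weight-weight∣ : ∀ a b →
  ℚ.∣ ℤ.+ weight a ℚ./ 1 ℚ.- ℤ.+ weight b ℚ./ 1 ∣ ≡ ℤ.+ weight (a xor b) ℚ./ 1
∣weight-weight∣ false false = refl
∣weight-weight∣ false true  = refl
∣weight-weight∣ true  false = refl
∣weight-weight∣ true  true  = refl

norm-seq : ∀ {m} n (v : ℝ^ m) (f : Vector ℕ m) → (∀ k → seq ∣ v k ∣ n ≡ ℤ.+ f k ℚ./ 1) →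
           seq ‖ v ‖₁ n ≡ ℤ.+ sum f ℚ./ 1
norm-seq {zero}  n v f eq = refl
norm-seq {suc m} n v f eq = trans
  (cong₂ ℚ._+_ (eq zero) (norm-seq n (v ∘ suc) (f ∘ suc) (eq ∘ suc)))
  (sym (/1-homo-+ (f zero) (sum (f ∘ suc))))

norm-indicator : ∀ {m} (f g : Vector Bool m) n →
                 seq ‖ indicator f ⊖ indicator g ‖₁ n ≡ ℤ.+ hamming f g ℚ./ 1
norm-indicator f g n = norm-seq n (indicator f ⊖ indicator g) (λ k → weight (f k xor g k))
  λ k → ∣weight-weight∣ (f k) (g k)

hamming-isometric : ∀ {m} (f g : Vector Bool m) →
                    fromℕℝ (hamming f g) ≃ ‖ indicator f ⊖ indicator g ‖₁
-- Both sides are the same constant sequence, so the threshold 0 serves every `ε`.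
hamming-isometric f g = mk≃ λ {ε} 0<ε → 0 , λ {n} _ →
  subst (λ q → ℚ.∣ ℤ.+ hamming f g ℚ./ 1 ℚ.- q ∣ ℚ.< ε) (sym (norm-indicator f g n))
        (RationalLemmas.dist-refl (ℤ.+ hamming f g ℚ./ 1) 0<ε)

theorem1p4 : (n : ℕ) (T : Tree n) → Isometrically-ℓ₁-Embeddable (Min4PC T) (n ∸ 1)
-- Without vertices there are no pairs, and `0 ∸ 1` is 0.
theorem1p4 zero    T = (λ _ ()) , λ { (mkV₂ () _ _) }
theorem1p4 (suc m) T = (λ p → indicator (separating p)) , isometric
  where
  open Distances T

  separating : V₂ (suc m) → Vector Bool m
  separating (mkV₂ i j _) e = cut e i xor cut e j

  isometric : ∀ p q → fromℕℝ (Min4PC T p q) ≃ ‖ indicator (separating p) ⊖ indicator (separating q) ‖₁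
  isometric p@(mkV₂ i j _) q@(mkV₂ k l _) =
    -- `parity i j k l` is by definition the Hamming distance between the two `separating` vectors.
    subst (λ D → fromℕℝ D ≃ ‖ indicator (separating p) ⊖ indicator (separating q) ‖₁)
          (sym (min4≡parity i j k l)) (hamming-isometric (separating p) (separating q))
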